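{- Consider the Normal Partizan Domination game on a star $K_{1,n}$ whose universal (center) vertex has color $C$, with $a$ leaves of color $A$, $b$ leaves of color $B$ and $c=n-a-b\geq 1$ leaves of color $C$, where $a+b\geq 1$. If $c$ is even, the value equals the value of the game on the star obtained by removing the $c$ leaves of color $C$. If $c$ is odd: if $a=b$ the value is $*$; if $|a-b|=1$ the value is $*2$; if $a\geq b+2$ the value is $\left\{0,\uparrow^{[a-b-1]}*\ \big|\ 0,\uparrow^{[a-b-1]}*\right\}$; if $b\geq a+2$ the value is $\left\{0,\downarrow_{[b-a-1]}*\ \big|\ 0,\downarrow_{[b-a-1]}*\right\}$.
   Context: Normal Partizan Domination game: a finite graph $G$ has each vertex colored $A$, $B$ or $C$. Alice and Bob alternately select a vertex; Alice may only select vertices colored $A$ or $C$, Bob only vertices colored $B$ or $C$. A vertex $u$ dominates $v$ if $u=v$ or $uv$ is an edge. A vertex may be selected only if it is playable, i.e. it dominates at least one vertex not dominated by the previously selected vertices; the game ends when the selected vertices form a dominating set. Under normal play the player unable to move loses. The game is regarded as a partizan combinatorial game with Alice as Left and Bob as Right, and its value is its value in Conway's combinatorial game theory ($\{X\mid Y\}$ has Left options $X$ and Right options $Y$; $G=H$ iff $G+(-H)$ is a second-player win). Notation: $*=\{0\mid 0\}$, $*2=\{0,*\mid 0,*\}$, $\uparrow=\{0\mid *\}$, $\downarrow=\{*\mid 0\}$; $\uparrow^{[1]}=\uparrow$, $\uparrow^{[m]}=\{\uparrow^{[m-1]}\mid *\}$ for $m\geq 2$; $\downarrow_{[1]}=\downarrow$,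 $\downarrow_{[m]}=\{*\mid \downarrow_{[m-1]}\}$ for $m\geq 2$; $J*$ denotes $J+*$. -}

module Defs where

open import Data.Fin.Base using (Fin; zero; suc)
open import Data.Fin.Subset using (Subset; _∈_; _∉_; _∪_; ⁅_⁆; _⊃_)
  renaming (⊥ to ∅)
open import Data.Fin.Subset.Induction using (⊃-wellFounded)
open import Data.Fin.Subset.Properties using (p⊆p∪q; x∈p∪q⁺; x∈⁅x⁆)
open import Data.List.Base using (List; []; _∷_; length; lookup; filter)
open import Data.Nat.Base using (ℕ; zero; suc)
open import Data.Product.Base using (Σ; Σ-syntax; ∃-syntax; _×_; _,_)
open import Data.Sum.Base using (_⊎_; inj₁; inj₂; [_,_])
open import Function.Base using (_∘_)
open import Induction.WellFounded using (Acc; acc)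
open import Level using (0ℓ)
open import Relation.Binary.Core using (Rel)
open import Relation.Binary.Definitions using (DecidableEquality; Irreflexive; Symmetric)
open import Relation.Binary.PropositionalEquality.Core using (_≡_; refl)
open import Relation.Nullary.Decidable.Core using (yes; no; ¬?)
open import Relation.Nullary.Negation.Core using (¬_)

data Game : Set₁ where
  mk : (L R : Set) → (L → Game) → (R → Game) → Game

⟨_∣_⟩ : List Game → List Game → Game
⟨ ls ∣ rs ⟩ = mk (Fin (length ls)) (Fin (length rs)) (lookup ls) (lookup rs)

infix  8 -_
infixl 6 _+_

-_ : Game → Game
- mk L R l r = mk R L (λ j → - r j) (λ i → - l i)

_+_ : Game → Game → Game
G@(mk L R l r) + H@(mk L′ R′ l′ r′) =
  mk (L ⊎ L′) (R ⊎ R′)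
     [ (λ i → l i + H) , (λ i → G + l′ i) ]
     [ (λ j → r j + H) , (λ j → G + r′ j) ]

-- LeftWinsFirst: Left wins when moving first; LeftWinsSecond: when moving
-- second. A player unable to move loses.
mutual
  LeftWinsFirst : Game → Set
  LeftWinsFirst (mk L R l r) = Σ[ i ∈ L ] LeftWinsSecond (l i)

  LeftWinsSecond : Game → Set
  LeftWinsSecond (mk L R l r) = ∀ (j : R) → LeftWinsFirst (r j)

mutual
  RightWinsFirst : Game → Set
  RightWinsFirst (mk L R l r) = Σ[ j ∈ R ] RightWinsSecond (r j)

  RightWinsSecond : Game → Set
  RightWinsSecond (mk L R l r) = ∀ (i : L) → RightWinsFirst (l i)

SecondPlayerWin : Game → Set
SecondPlayerWin G = LeftWinsSecond G × RightWinsSecond G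

infix 4 _≈_

_≈_ : Game → Game → Set
G ≈ H = SecondPlayerWin (G + (- H))

𝟎 ⋆ ⋆2 : Game
𝟎  = ⟨ [] ∣ [] ⟩
⋆  = ⟨ 𝟎 ∷ [] ∣ 𝟎 ∷ [] ⟩
⋆2 = ⟨ 𝟎 ∷ ⋆ ∷ [] ∣ 𝟎 ∷ ⋆ ∷ [] ⟩

-- Starting at exponent 0 with 𝟎 makes exponent 1 unfold to
-- ↑ = ⟨ 𝟎 ∣ ⋆ ⟩ and ↓ = ⟨ ⋆ ∣ 𝟎 ⟩ respectively.
↑[_] : ℕ → Game
↑[ zero  ] = 𝟎
↑[ suc m ] = ⟨ ↑[ m ] ∷ [] ∣ ⋆ ∷ [] ⟩

↓[_] : ℕ → Game
↓[ zero  ] = 𝟎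
↓[ suc m ] = ⟨ ⋆ ∷ [] ∣ ↓[ m ] ∷ [] ⟩

record Graph (n : ℕ) : Set₁ where
  field
    Adj    : Rel (Fin n) 0ℓ
    sym    : Symmetric Adj
    irrefl : Irreflexive _≡_ Adj

data Colour : Set where
  A B C : Colour

AliceMaySelect BobMaySelect : Colour → Set
AliceMaySelect k = k ≡ A ⊎ k ≡ C
BobMaySelect   k = k ≡ B ⊎ k ≡ C

module Domination {n} (G : Graph n) (colour : Fin n → Colour) where
  open Graph G

  Dominates : Rel (Fin n) 0ℓ
  Dominates u v = u ≡ v ⊎ Adj u v

  -- S is the set of vertices selected so far.
  Dominated : Subset n → Fin n → Set
  Dominated S v = ∃[ u ] u ∈ S × Dominates u v

  Playable : Subset n → Fin n → Set
  Playable S u = ∃[ v ] Dominates u v × ¬ Dominated S v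

  AliceMove BobMove : Subset n → Set
  AliceMove S = Σ[ u ∈ Fin n ] AliceMaySelect (colour u) × Playable S u
  BobMove   S = Σ[ u ∈ Fin n ] BobMaySelect   (colour u) × Playable S u

  select : Subset n → Fin n → Subset n
  select S u = S ∪ ⁅ u ⁆

  playable⇒∉ : ∀ {S u} → Playable S u → u ∉ S
  playable⇒∉ (v , u▷v , v∉) u∈S = v∉ (_ , u∈S , u▷v)

  playable⇒⊃ : ∀ {S u} → Playable S u → select S u ⊃ S
  playable⇒⊃ {S} {u} p =
    p⊆p∪q ⁅ u ⁆ , u , x∈p∪q⁺ (inj₂ (x∈⁅x⁆ u)) , playable⇒∉ {S} p

  -- The end of the game needs no separate clause: once S is dominating no
  -- vertex is playable.
  position : (S : Subset n) → Acc _⊃_ S → Game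
  position S (acc rs) = mk (AliceMove S) (BobMove S)
    (λ (u , _ , p) → position (select S u) (rs (playable⇒⊃ p)))
    (λ (u , _ , p) → position (select S u) (rs (playable⇒⊃ p)))

  game : Game
  game = position ∅ (⊃-wellFounded ∅)

data StarAdj {n} : Rel (Fin (suc n)) 0ℓ where
  centre-leaf : ∀ {i} → StarAdj zero (suc i)
  leaf-centre : ∀ {i} → StarAdj (suc i) zero

K₁,_ : ∀ n → Graph (suc n)
K₁, n = record
  { Adj    = StarAdj
  ; sym    = λ { centre-leaf → leaf-centre ; leaf-centre → centre-leaf }
  ; irrefl = λ { refl () }
  }

-- The star with centre coloured C and one leaf for each entry of the list,
-- coloured by that entry.
starGame : List Colour → Game
starGame leaves = Domination.game (K₁, length leaves) (lookup (C ∷ leaves))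

infix 4 _≟_

_≟_ : DecidableEquality Colour
A ≟ A = yes refl
A ≟ B = no λ ()
A ≟ C = no λ ()
B ≟ A = no λ ()
B ≟ B = yes refl
B ≟ C = no λ ()
C ≟ A = no λ ()
C ≟ B = no λ ()
C ≟ C = yes refl

count : Colour → List Colour → ℕ
count k leaves = length (filter (k ≟_) leaves)

remove : Colour → List Colour → List Colour
remove k leaves = filter (¬? ∘ (k ≟_)) leaves

{-# OPTIONS --safe #-}
module Submission where

-- With a, b and c undominated leaves of colour A, B and C left, the position depends
-- only on (a, b, c), and selecting the centre moves to 0. Two C leaves, or one A and
-- one B leaf, cancel: whoever faces a move on one of them takes the other, and every
-- other move is mirrored in the second component of the difference. This reduces an
-- odd star to (a − b, 0, 1) when a ≥ b, which equals {0, X | 0, X} with X = (a − b, 0, 0)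
-- for a > b and * for a = b, and induction gives (m + 1, 0, 0) = ↑[m] + *. The case
-- b > a follows since negation exchanges the two players.

open import Defs
open import Data.List.Base using (List; []; _∷_)
open import Data.Nat.Base using (ℕ; _∸_; _≤_; ∣_-_∣) renaming (_+_ to _+ℕ_)
open import Data.Nat.Divisibility.Core using (_∣_)
open import Data.Product.Base using (_×_)
open import Relation.Binary.PropositionalEquality.Core using (_≡_)
open import Relation.Nullary.Negation.Core using (¬_)
open import Data.Empty using (⊥-elim)
open import Data.Fin.Base using (Fin; zero; suc)
open import Data.Fin.Subset using (Subset; _∈_; _∉_; _∪_; ⁅_⁆; inside; outside)
  renaming (⊥ to ∅)
open import Data.Fin.Subset.Induction using (⊃-wellFounded)
open import Data.Fin.Subset.Properties using (∪-identityʳ; drop-there)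
open import Data.List.Base using (length; lookup)
open import Data.List.Relation.Binary.Permutation.Propositional
  using (_↭_; ↭-refl; ↭-trans; prep; swap)
open import Data.List.Relation.Binary.Permutation.Propositional.Properties
  using (filter-↭; ↭-length)
open import Data.Nat.Base using (zero; suc; _*_; s≤s)
open import Data.Nat.Divisibility using (_∣0; ∣-refl; ∣m∣n⇒∣m+n)
open import Data.Nat.Divisibility.Core using (divides)
open import Data.Nat.Properties using (+-identityʳ)
open import Data.Product.Base using (∃-syntax; _,_; proj₁; proj₂; map₂)
open import Data.Sum.Base using (_⊎_; inj₁; inj₂; [_,_])
open import Data.Vec.Base using ([]; _∷_; here; there)
open import Function.Base using (_∘_; id)
open import Induction.WellFounded using (acc)
open import Relation.Binary.PropositionalEquality.Core using (refl; sym; trans; cong; subst)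
open import Relation.Nullary.Decidable.Core using (yes; no)

-- Conway's order and its relation to winning strategies.

LeftMove RightMove : Game → Set
LeftMove  (mk L R l r) = L
RightMove (mk L R l r) = R

leftOption : ∀ G → LeftMove G → Game
leftOption (mk L R l r) = l

rightOption : ∀ G → RightMove G → Game
rightOption (mk L R l r) = r

infix 4 _≼_ _⧏_ _≃_

-- Conway's order, with G ⧏ H ("Left wins H − G moving first") in place of ¬ (H ≼ G).
mutual
  data _≼_ (G H : Game) : Set where
    le : (∀ i → leftOption G i ⧏ H) → (∀ j → G ⧏ rightOption H j) → G ≼ H

  data _⧏_ (G H : Game) : Set where
    byLeft  : ∀ i → G ≼ leftOption H i → G ⧏ H
    byRight : ∀ j → rightOption G j ≼ H → G ⧏ H

≼-refl : ∀ {G} → G ≼ G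
≼-refl {mk L R l r} = le (λ i → byLeft i (≼-refl {l i})) (λ j → byRight j (≼-refl {r j}))

mutual
  ≼-trans : ∀ {G H K} → G ≼ H → H ≼ K → G ≼ K
  ≼-trans p@(le pl _) q@(le _ qr) = le (λ i → ⧏-≼-trans (pl i) q) (λ j → ≼-⧏-trans p (qr j))

  ⧏-≼-trans : ∀ {G H K} → G ⧏ H → H ≼ K → G ⧏ K
  ⧏-≼-trans (byLeft i p)  (le ql _) = ≼-⧏-trans p (ql i)
  ⧏-≼-trans (byRight j p) q         = byRight j (≼-trans p q)

  ≼-⧏-trans : ∀ {G H K} → G ≼ H → H ⧏ K → G ⧏ K
  ≼-⧏-trans p         (byLeft i q)  = byLeft i (≼-trans p q)
  ≼-⧏-trans (le _ pr) (byRight j q) = ⧏-≼-trans (pr j) q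

mutual
  neg-≼ : ∀ {G H} → G ≼ H → - H ≼ - G
  neg-≼ {mk _ _ _ _} {mk _ _ _ _} (le pl pr) = le (λ j → neg-⧏ (pr j)) (λ i → neg-⧏ (pl i))

  neg-⧏ : ∀ {G H} → G ⧏ H → - H ⧏ - G
  neg-⧏ {H = mk _ _ _ _} (byLeft i p)  = byRight i (neg-≼ p)
  neg-⧏ {G = mk _ _ _ _} (byRight j p) = byLeft j (neg-≼ p)

mutual
  -- Right opens `G + - H` with a right option of `G` or with a negated left option of `H`. These
  -- are the two fields of `le`, and the `⧏` found there is Left's winning reply.
  ≼⇒LeftWinsSecond : ∀ {G H} → H ≼ G → LeftWinsSecond (G + - H)
  ≼⇒LeftWinsSecond {mk _ _ _ _} {mk _ _ _ _} (le pl pr) (inj₁ j) = ⧏⇒LeftWinsFirst (pr j)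
  ≼⇒LeftWinsSecond {mk _ _ _ _} {mk _ _ _ _} (le pl pr) (inj₂ i) = ⧏⇒LeftWinsFirst (pl i)

  ⧏⇒LeftWinsFirst : ∀ {G H} → H ⧏ G → LeftWinsFirst (G + - H)
  ⧏⇒LeftWinsFirst {mk _ _ _ _} {mk _ _ _ _} (byLeft i p)  = inj₁ i , ≼⇒LeftWinsSecond p
  ⧏⇒LeftWinsFirst {mk _ _ _ _} {mk _ _ _ _} (byRight j p) = inj₂ j , ≼⇒LeftWinsSecond p

mutual
  ≼⇒RightWinsSecond : ∀ {G H} → G ≼ H → RightWinsSecond (G + - H)
  ≼⇒RightWinsSecond {mk _ _ _ _} {mk _ _ _ _} (le pl pr) (inj₁ i) = ⧏⇒RightWinsFirst (pl i)
  ≼⇒RightWinsSecond {mk _ _ _ _} {mk _ _ _ _} (le pl pr) (inj₂ j) = ⧏⇒RightWinsFirst (pr j)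

  ⧏⇒RightWinsFirst : ∀ {G H} → G ⧏ H → RightWinsFirst (G + - H)
  ⧏⇒RightWinsFirst {mk _ _ _ _} {mk _ _ _ _} (byLeft i p)  = inj₂ i , ≼⇒RightWinsSecond p
  ⧏⇒RightWinsFirst {mk _ _ _ _} {mk _ _ _ _} (byRight j p) = inj₁ j , ≼⇒RightWinsSecond p

-- Equality of games and matching of options.

_≃_ : Game → Game → Set
G ≃ H = G ≼ H × H ≼ G

≃-refl : ∀ {G} → G ≃ G
≃-refl = ≼-refl , ≼-refl

≃-sym : ∀ {G H} → G ≃ H → H ≃ G
≃-sym (p , q) = q , p

≃-trans : ∀ {G H K} → G ≃ H → H ≃ K → G ≃ K
≃-trans (p , q) (p′ , q′) = ≼-trans p p′ , ≼-trans q′ q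

neg-≃ : ∀ {G H} → G ≃ H → - G ≃ - H
neg-≃ (p , q) = neg-≼ q , neg-≼ p

≃⇒≈ : ∀ {G H} → G ≃ H → G ≈ H
≃⇒≈ (p , q) = ≼⇒LeftWinsSecond q , ≼⇒RightWinsSecond p

-- Sufficient for equality but not necessary: dominated or reversible options can leave equal games
-- without a match, and such cases are proved with `le` directly.
Match : {I J : Set} → (I → Game) → (J → Game) → Set
Match {I} {J} f g = (∀ i → ∃[ j ] f i ≃ g j) × (∀ j → ∃[ i ] f i ≃ g j)

pointwise : {I : Set} {f g : I → Game} → (∀ i → f i ≃ g i) → Match f g
pointwise e = (λ i → i , e i) , (λ i → i , e i)

≃-match : ∀ {G H} → Match (leftOption G) (leftOption H) →
          Match (rightOption G) (rightOption H) → G ≃ H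
≃-match (l→ , l←) (r→ , r←) =
  le (λ i → let (k , p , _) = l→ i in byLeft k p) (λ j → let (k , p , _) = r← j in byRight k p) ,
  le (λ i → let (k , _ , p) = l← i in byLeft k p) (λ j → let (k , _ , p) = r→ j in byRight k p)

-𝟎≃𝟎 : - 𝟎 ≃ 𝟎
-𝟎≃𝟎 = le (λ ()) (λ ()) , le (λ ()) (λ ())

singleton-match : (f : Game → Game) → ∀ {X Y} → f X ≃ Y →
  Match (f ∘ lookup (X ∷ [])) (lookup (Y ∷ []))
singleton-match f e = (λ { zero → zero , e }) , (λ { zero → zero , e })

-⋆≃⋆ : - ⋆ ≃ ⋆
-⋆≃⋆ = ≃-match (singleton-match -_ -𝟎≃𝟎) (singleton-match -_ -𝟎≃𝟎)

-↑≃↓ : ∀ m → - ↑[ m ] ≃ ↓[ m ]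
-↑≃↓ zero    = -𝟎≃𝟎
-↑≃↓ (suc m) = ≃-match (singleton-match -_ -⋆≃⋆) (singleton-match -_ (-↑≃↓ m))

-- Sums of games.

mutual
  +-mono-≼ : ∀ {G G′ H H′} → G ≼ G′ → H ≼ H′ → G + H ≼ G′ + H′
  +-mono-≼ {mk _ _ _ _} {mk _ _ _ _} {mk _ _ _ _} {mk _ _ _ _} p@(le pl pr) q@(le ql qr) =
    le [ (λ i → +-mono-⧏ˡ (pl i) q) , (λ i → +-mono-⧏ʳ p (ql i)) ]
       [ (λ j → +-mono-⧏ˡ (pr j) q) , (λ j → +-mono-⧏ʳ p (qr j)) ]

  +-mono-⧏ˡ : ∀ {G G′ H H′} → G ⧏ G′ → H ≼ H′ → G + H ⧏ G′ + H′
  +-mono-⧏ˡ {mk _ _ _ _} {mk _ _ _ _} {mk _ _ _ _} {mk _ _ _ _} (byLeft i p)  q =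
    byLeft (inj₁ i) (+-mono-≼ p q)
  +-mono-⧏ˡ {mk _ _ _ _} {mk _ _ _ _} {mk _ _ _ _} {mk _ _ _ _} (byRight j p) q =
    byRight (inj₁ j) (+-mono-≼ p q)

  +-mono-⧏ʳ : ∀ {G G′ H H′} → G ≼ G′ → H ⧏ H′ → G + H ⧏ G′ + H′
  +-mono-⧏ʳ {mk _ _ _ _} {mk _ _ _ _} {mk _ _ _ _} {mk _ _ _ _} p (byLeft i q)  =
    byLeft (inj₂ i) (+-mono-≼ p q)
  +-mono-⧏ʳ {mk _ _ _ _} {mk _ _ _ _} {mk _ _ _ _} {mk _ _ _ _} p (byRight j q) =
    byRight (inj₂ j) (+-mono-≼ p q)

+-cong : ∀ {G G′ H H′} → G ≃ G′ → H ≃ H′ → G + H ≃ G′ + H′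
+-cong (p , p′) (q , q′) = +-mono-≼ p q , +-mono-≼ p′ q′

neg-+ : ∀ G H → - (G + H) ≃ - G + - H
neg-+ G@(mk _ _ l r) H@(mk _ _ l′ r′) = ≃-match
  (pointwise [ (λ j → neg-+ (r j) H) , (λ j → neg-+ G (r′ j)) ])
  (pointwise [ (λ i → neg-+ (l i) H) , (λ i → neg-+ G (l′ i)) ])

-- The star as a game on leaf counts.

data Nonempty : ℕ → ℕ → ℕ → Set where
  some₁ : ∀ {x y c} → Nonempty (suc x) y c
  some₂ : ∀ {x y c} → Nonempty x (suc y) c
  some₃ : ∀ {x y c} → Nonempty x y (suc c)

Nonempty-swap : ∀ {x y c} → Nonempty x y c → Nonempty y x c
Nonempty-swap some₁ = some₂
Nonempty-swap some₂ = some₁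
Nonempty-swap some₃ = some₃

-- The moves of a player owning x leaves, the opponent owning y, with c leaves in common.
data Move : ℕ → ℕ → ℕ → Set where
  centre : ∀ {x y c} → Nonempty x y c → Move x y c
  own    : ∀ {x y c} → Move (suc x) y c
  common : ∀ {x y c} → Move x y (suc c)

-- The star with a, b and c undominated leaves of colour A, B and C.
mutual
  star : ℕ → ℕ → ℕ → Game
  star a b c = mk (Move a b c) (Move b a c) (aliceOption a b c) (bobOption a b c)

  aliceOption : ∀ a b c → Move a b c → Game
  aliceOption a       b c       (centre _) = 𝟎
  aliceOption (suc a) b c       own        = star a b c
  aliceOption a       b (suc c) common     = star a b c

  bobOption : ∀ a b c → Move b a c → Game
  bobOption a b       c       (centre _) = 𝟎
  bobOption a (suc b) c       own        = star a b c
  bobOption a b       (suc c) common     = star a b c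

-- Exchanging the colours A and B exchanges the players. Both sides have the same types of moves, so
-- each move is matched with itself.
star-swap : ∀ a b c → star b a c ≃ - star a b c
star-swap a b c = ≃-match (pointwise (onLeft a b c)) (pointwise (onRight a b c))
  where
  onLeft : ∀ a b c m → aliceOption b a c m ≃ - bobOption a b c m
  onLeft a b       c       (centre _) = ≃-sym -𝟎≃𝟎
  onLeft a (suc b) c       own        = star-swap a b c
  onLeft a b       (suc c) common     = star-swap a b c

  onRight : ∀ a b c m → bobOption b a c m ≃ - aliceOption a b c m
  onRight a       b c       (centre _) = ≃-sym -𝟎≃𝟎
  onRight (suc a) b c       own        = star-swap a b c
  onRight a       b (suc c) common     = star-swap a b c

empty? : ∀ a b c → Nonempty a b c ⊎ (a ≡ 0 × b ≡ 0 × c ≡ 0)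
empty? (suc a) b       c       = inj₁ some₁
empty? 0       (suc b) c       = inj₁ some₂
empty? 0       0       (suc c) = inj₁ some₃
empty? 0       0       0       = inj₂ (refl , refl , refl)

𝟎≼empty : 𝟎 ≼ star 0 0 0
𝟎≼empty = le (λ ()) λ { (centre ()) }

empty≼𝟎 : star 0 0 0 ≼ 𝟎
empty≼𝟎 = le (λ { (centre ()) }) (λ ())

-- Either player can end a nonempty star at once by selecting the centre. With `star⧏𝟎`, every
-- nonempty star is confused with `𝟎`.
𝟎⧏star : ∀ {a b c} → Nonempty a b c → 𝟎 ⧏ star a b c
𝟎⧏star ne = byLeft (centre ne) ≼-refl

star⧏𝟎 : ∀ {a b c} → Nonempty a b c → star a b c ⧏ 𝟎
star⧏𝟎 ne = byRight (centre (Nonempty-swap ne)) ≼-refl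

star⧏empty : ∀ {a b c} → Nonempty a b c → star a b c ⧏ star 0 0 0
star⧏empty ne = ⧏-≼-trans (star⧏𝟎 ne) 𝟎≼empty

empty⧏star : ∀ {a b c} → Nonempty a b c → star 0 0 0 ⧏ star a b c
empty⧏star ne = ≼-⧏-trans empty≼𝟎 (𝟎⧏star ne)

-- Cancellation of pairs of leaves.

C≼A : star 0 0 1 ≼ star 1 0 0
C≼A = le (λ { (centre _) → 𝟎⧏star some₁ ; common → empty⧏star some₁ })
         (λ { (centre _) → star⧏𝟎 some₃ })

-- With a single leaf left every move ends the game and the centre is open to both players, so the
-- colour of that leaf does not affect the value.
A≼C : star 1 0 0 ≼ star 0 0 1
A≼C = le (λ { (centre _) → 𝟎⧏star some₃ ; own → empty⧏star some₃ })
         (λ { (centre _) → star⧏𝟎 some₁ ; common → star⧏empty some₁ })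

-- When a mirroring reply would leave the empty star, the centre or, failing that,
-- a move to a star with a single leaf takes its place.
CC-≼ : ∀ a b c → Nonempty a b c → star a b (2 +ℕ c) ≼ star a b c
CC-≼ a b c ne = le (onLeft a b c ne) (onRight a b c)
  where
  onLeft : ∀ a b c → Nonempty a b c → ∀ m → aliceOption a b (2 +ℕ c) m ⧏ star a b c
  onLeft a       b c ne (centre _) = 𝟎⧏star ne
  onLeft a       b c ne common     = byRight common ≼-refl
  onLeft (suc a) b c ne own with empty? a b c
  ... | inj₁ ne′                  = byLeft own (CC-≼ a b c ne′)
  ... | inj₂ (refl , refl , refl) = byRight common C≼A

  onRight : ∀ a b c m → star a b (2 +ℕ c) ⧏ bobOption a b c m
  onRight a b       c       (centre _) = star⧏𝟎 some₃
  onRight a (suc b) c       own with empty? a b c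
  ... | inj₁ ne′                  = byRight own (CC-≼ a b c ne′)
  ... | inj₂ (refl , refl , refl) = star⧏empty some₂
  onRight a b       (suc c) common with empty? a b c
  ... | inj₁ ne′                  = byRight common (CC-≼ a b c ne′)
  ... | inj₂ (refl , refl , refl) = star⧏empty some₃

-- An A leaf taken by Alice in the larger star is answered with a B leaf there, which restores
-- `star a b c`. Otherwise the replies follow the pattern of `CC-≼`, with `A≼C` comparing single
-- leaves when a mirrored common move would empty the smaller star.
AB-≼ : ∀ a b c → Nonempty a b c → star (suc a) (suc b) c ≼ star a b c
AB-≼ a b c ne = le (onLeft a b c ne) (onRight a b c)
  where
  onLeft : ∀ a b c → Nonempty a b c → ∀ m → aliceOption (suc a) (suc b) c m ⧏ star a b c
  onLeft a b c       ne (centre _) = 𝟎⧏star ne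
  onLeft a b c       ne own        = byRight own ≼-refl
  onLeft a b (suc c) ne common with empty? a b c
  ... | inj₁ ne′                  = byLeft common (AB-≼ a b c ne′)
  ... | inj₂ (refl , refl , refl) = byRight own A≼C

  onRight : ∀ a b c m → star (suc a) (suc b) c ⧏ bobOption a b c m
  onRight a b       c       (centre _) = star⧏𝟎 some₁
  onRight a (suc b) c       own with empty? a b c
  ... | inj₁ ne′                  = byRight own (AB-≼ a b c ne′)
  ... | inj₂ (refl , refl , refl) = star⧏empty some₁
  onRight a b       (suc c) common with empty? a b c
  ... | inj₁ ne′                  = byRight common (AB-≼ a b c ne′)
  ... | inj₂ (refl , refl , refl) = star⧏empty some₁

-- Negation turns an inequality for the stars with A and B exchanged into the opposite inequality,
-- so one direction of each cancellation suffices.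
reverse-≼ : ∀ {a b c a′ b′ c′} → star b a c ≼ star b′ a′ c′ → star a′ b′ c′ ≼ star a b c
reverse-≼ {a} {b} {c} {a′} {b′} {c′} p =
  ≼-trans (proj₁ (star-swap b′ a′ c′)) (≼-trans (neg-≼ p) (proj₂ (star-swap b a c)))

-- Some other leaf must remain: two C leaves alone let the first player win with the centre, whereas
-- the empty star equals `𝟎`.
CC-≃ : ∀ a b c → Nonempty a b c → star a b (2 +ℕ c) ≃ star a b c
CC-≃ a b c ne = CC-≼ a b c ne , reverse-≼ (CC-≼ b a c (Nonempty-swap ne))

AB-≃ : ∀ a b c → Nonempty a b c → star (suc a) (suc b) c ≃ star a b c
AB-≃ a b c ne = AB-≼ a b c ne , reverse-≼ (AB-≼ b a c (Nonempty-swap ne))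

Nonempty-+ : ∀ {a b c} n → Nonempty a b c → Nonempty a b (n +ℕ c)
Nonempty-+ zero    ne = ne
Nonempty-+ (suc n) ne = some₃

CCs-≃ : ∀ a b c k → Nonempty a b c → star a b (k * 2 +ℕ c) ≃ star a b c
CCs-≃ a b c zero    ne = ≃-refl
CCs-≃ a b c (suc k) ne = ≃-trans (CC-≃ a b (k * 2 +ℕ c) (Nonempty-+ (k * 2) ne)) (CCs-≃ a b c k ne)

-- The C leaf keeps every intermediate star nonempty, so all B leaves cancel even when `d` is zero.
ABs-≃ : ∀ b d → star (b +ℕ d) b 1 ≃ star d 0 1
ABs-≃ zero    d = ≃-refl
ABs-≃ (suc b) d = ≃-trans (AB-≃ (b +ℕ d) b 1 some₃) (ABs-≃ b d)

-- Values of stars with A leaves and at most one C leaf.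

⋆≼star : ∀ a → ⋆ ≼ star (suc a) 0 0
⋆≼star a = le (λ { zero → 𝟎⧏star some₁ }) (λ { (centre _) → byRight zero ≼-refl })

𝟎+𝟎≃𝟎 : 𝟎 + 𝟎 ≃ 𝟎
𝟎+𝟎≃𝟎 = le (λ { (inj₁ ()) ; (inj₂ ()) }) (λ ()) , le (λ ()) (λ { (inj₁ ()) ; (inj₂ ()) })

𝟎≼↑ : ∀ m → 𝟎 ≼ ↑[ m ] + 𝟎
𝟎≼↑ zero    = proj₂ 𝟎+𝟎≃𝟎
𝟎≼↑ (suc m) = le (λ ()) λ { (inj₁ zero) → byLeft (inj₁ zero) (proj₂ 𝟎+𝟎≃𝟎) ; (inj₂ ()) }

⋆+𝟎≼⋆ : ⋆ + 𝟎 ≼ ⋆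
⋆+𝟎≼⋆ = le (λ { (inj₁ zero) → byLeft zero (proj₁ 𝟎+𝟎≃𝟎) ; (inj₂ ()) })
           (λ { zero → byRight (inj₁ zero) (proj₁ 𝟎+𝟎≃𝟎) })

⋆+⋆≼𝟎 : ⋆ + ⋆ ≼ 𝟎
⋆+⋆≼𝟎 = le (λ { (inj₁ zero) → byRight (inj₂ zero) (proj₁ 𝟎+𝟎≃𝟎)
              ; (inj₂ zero) → byRight (inj₁ zero) (proj₁ 𝟎+𝟎≃𝟎) }) (λ ())

𝟎≼⋆+⋆ : 𝟎 ≼ ⋆ + ⋆
𝟎≼⋆+⋆ = le (λ ())
           (λ { (inj₁ zero) → byLeft (inj₂ zero) (proj₂ 𝟎+𝟎≃𝟎)
              ; (inj₂ zero) → byLeft (inj₁ zero) (proj₂ 𝟎+𝟎≃𝟎) })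

-- In the inductive step, an A leaf corresponds to Left's move to `↑[ m ] + ⋆`, and Bob's centre to
-- Right's move to `⋆ + ⋆`, which equals `𝟎`. Alice's centre and Right's move in the summand `⋆` are
-- dominated, since `𝟎` lies below `↑[ suc m ] + 𝟎`.
starAs≃↑⋆ : ∀ m → star (suc m) 0 0 ≃ ↑[ m ] + ⋆
starAs≃↑⋆ zero =
  le (λ { (centre _) → byLeft (inj₂ zero) (𝟎≼↑ 0) ; own → byLeft (inj₂ zero) (≼-trans empty≼𝟎 (𝟎≼↑ 0)) })
     (λ { (inj₂ zero) → byRight (centre some₂) (𝟎≼↑ 0) }) ,
  le (λ { (inj₂ zero) → byLeft (centre some₁) (proj₁ 𝟎+𝟎≃𝟎) })
     (λ { (centre _) → byRight (inj₂ zero) (proj₁ 𝟎+𝟎≃𝟎) })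
starAs≃↑⋆ (suc m) =
  le (λ { (centre _) → byLeft (inj₂ zero) (𝟎≼↑ (suc m)) ; own → byLeft (inj₁ zero) (proj₁ (starAs≃↑⋆ m)) })
     (λ { (inj₁ zero) → byRight (centre some₂) 𝟎≼⋆+⋆ ; (inj₂ zero) → byRight (centre some₂) (𝟎≼↑ (suc m)) }) ,
  le (λ { (inj₁ zero) → byLeft own (proj₂ (starAs≃↑⋆ m))
        -- Left's move to `↑[ suc m ] + 𝟎` is reversible: Right answers with `⋆ + 𝟎`, which lies
        -- below the star.
        ; (inj₂ zero) → byRight (inj₁ zero) (≼-trans ⋆+𝟎≼⋆ (⋆≼star (suc m))) })
     (λ { (centre _) → byRight (inj₁ zero) ⋆+⋆≼𝟎 })

-- Recolouring the C leaf as A preserves Alice's moves and leaves Bob only the centre. Hence taking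
-- an A leaf while a C leaf remains is dominated, for Alice, by taking the C leaf.
AsC≼As : ∀ a → star a 0 1 ≼ star (suc a) 0 0
AsC≼As zero    = C≼A
AsC≼As (suc a) =
  le (λ { (centre _) → 𝟎⧏star some₁
        ; own        → byLeft own (AsC≼As a)
        ; common     → byLeft own ≼-refl })
     (λ { (centre _) → star⧏𝟎 some₁ })

-- `pair ⋆` unfolds to `⋆2`, so differences of one and of at least two are treated alike.
pair : Game → Game
pair X = ⟨ 𝟎 ∷ X ∷ [] ∣ 𝟎 ∷ X ∷ [] ⟩

pair-match : (f : Game → Game) → ∀ {X Y} → f 𝟎 ≃ 𝟎 → f X ≃ Y →
  Match (f ∘ lookup (𝟎 ∷ X ∷ [])) (lookup (𝟎 ∷ Y ∷ []))
pair-match f e₀ e₁ = (λ { zero → zero , e₀ ; (suc zero) → suc zero , e₁ }) ,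
                     (λ { zero → zero , e₀ ; (suc zero) → suc zero , e₁ })

pair-cong : ∀ {X Y} → X ≃ Y → pair X ≃ pair Y
pair-cong e = ≃-match (pair-match id ≃-refl e) (pair-match id ≃-refl e)

neg-pair : ∀ {X Y} → - X ≃ Y → - pair X ≃ pair Y
neg-pair e = ≃-match (pair-match -_ -𝟎≃𝟎 e) (pair-match -_ -𝟎≃𝟎 e)

-- For both players the centre gives `𝟎` and the C leaf gives the other option. Only Alice has a
-- further move, an A leaf, and `AsC≼As` shows it to be dominated.
starAsC≃pair : ∀ a → star (suc a) 0 1 ≃ pair (star (suc a) 0 0)
starAsC≃pair a =
  le (λ { (centre _) → byLeft zero ≼-refl
        ; own        → byLeft (suc zero) (AsC≼As a)
        ; common     → byLeft (suc zero) ≼-refl })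
     (λ { zero → star⧏𝟎 some₁ ; (suc zero) → byRight common ≼-refl }) ,
  le (λ { zero → 𝟎⧏star some₁ ; (suc zero) → byLeft common ≼-refl })
     (λ { (centre _) → byRight zero ≼-refl ; common → byRight (suc zero) ≼-refl })

starC≃⋆ : star 0 0 1 ≃ ⋆
starC≃⋆ =
  ≃-match ((λ { (centre _) → zero , ≃-refl ; common → zero , empty≼𝟎 , 𝟎≼empty })
          , λ { zero → centre some₃ , ≃-refl })
          ((λ { (centre _) → zero , ≃-refl ; common → zero , empty≼𝟎 , 𝟎≼empty })
          , λ { zero → centre some₃ , ≃-refl })

starA≃⋆ : star 1 0 0 ≃ ⋆
starA≃⋆ = ≃-trans (A≼C , C≼A) starC≃⋆

-- Values of stars with an odd number of C leaves.

oddStar≃ : ∀ b d k → star (b +ℕ d) b (k * 2 +ℕ 1) ≃ star d 0 1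
oddStar≃ b d k = ≃-trans (CCs-≃ (b +ℕ d) b 1 k some₃) (ABs-≃ b d)

oddStar-⋆ : ∀ b k → star (b +ℕ 0) b (k * 2 +ℕ 1) ≃ ⋆
oddStar-⋆ b k = ≃-trans (oddStar≃ b 0 k) starC≃⋆

oddStar-⋆2 : ∀ b k → star (b +ℕ 1) b (k * 2 +ℕ 1) ≃ ⋆2
oddStar-⋆2 b k = ≃-trans (oddStar≃ b 1 k) (≃-trans (starAsC≃pair 0) (pair-cong starA≃⋆))

oddStar-↑ : ∀ b m k → star (b +ℕ suc m) b (k * 2 +ℕ 1) ≃ pair (↑[ m ] + ⋆)
oddStar-↑ b m k = ≃-trans (oddStar≃ b (suc m) k) (≃-trans (starAsC≃pair m) (pair-cong (starAs≃↑⋆ m)))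

mirror : ∀ {a b c G H} → star b a c ≃ G → - G ≃ H → star a b c ≃ H
mirror {a} {b} {c} p q = ≃-trans (star-swap b a c) (≃-trans (neg-≃ p) q)

oddStar-↓ : ∀ a m k → star a (a +ℕ suc m) (k * 2 +ℕ 1) ≃ pair (↓[ m ] + ⋆)
oddStar-↓ a m k = mirror (oddStar-↑ a m k)
  (neg-pair (≃-trans (neg-+ ↑[ m ] ⋆) (+-cong (-↑≃↓ m) -⋆≃⋆)))

-- From positions of the graph game to leaf counts.

unselected : (ls : List Colour) → Subset (length ls) → List Colour
unselected []       []            = []
unselected (x ∷ ls) (outside ∷ p) = x ∷ unselected ls p
unselected (x ∷ ls) (inside  ∷ p) = unselected ls p

unselected-∅ : ∀ ls → unselected ls ∅ ≡ ls
unselected-∅ []       = refl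
unselected-∅ (x ∷ ls) = cong (x ∷_) (unselected-∅ ls)

unselected-select : ∀ ls p i → i ∉ p →
  unselected ls p ↭ lookup ls i ∷ unselected ls (p ∪ ⁅ i ⁆)
unselected-select (x ∷ ls) (outside ∷ p) zero    i∉p rewrite ∪-identityʳ p = ↭-refl
unselected-select (x ∷ ls) (inside  ∷ p) zero    i∉p = ⊥-elim (i∉p here)
unselected-select (x ∷ ls) (outside ∷ p) (suc i) i∉p =
  ↭-trans (prep x (unselected-select ls p i (i∉p ∘ there))) (swap x (lookup ls i) ↭-refl)
unselected-select (x ∷ ls) (inside  ∷ p) (suc i) i∉p = unselected-select ls p i (i∉p ∘ there)

count-↭ : ∀ k {xs ys} → xs ↭ ys → count k xs ≡ count k ys
count-↭ k xs↭ys = ↭-length (filter-↭ (k ≟_) xs↭ys)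

-- Provides the vertex that realises a move of the counted star.
∃-unselected : ∀ k ls p {m} → count k (unselected ls p) ≡ suc m →
  ∃[ i ] lookup ls i ≡ k × i ∉ p
∃-unselected k (x ∷ ls) (outside ∷ p) eq with k ≟ x
... | yes refl = zero , refl , λ ()
... | no _     = let (i , e , i∉p) = ∃-unselected k ls p eq in suc i , e , i∉p ∘ drop-there
∃-unselected k (x ∷ ls) (inside  ∷ p) eq =
  let (i , e , i∉p) = ∃-unselected k ls p eq in suc i , e , i∉p ∘ drop-there
∃-unselected k [] [] ()

module Position (ls : List Colour) (i₀ : Fin (length ls)) where
  open Domination (K₁, length ls) (lookup (C ∷ ls))

  centre-ends : ∀ {p} u → ¬ Playable (inside ∷ p) u
  centre-ends u (zero  , _ , free) = free (zero , here , inj₁ refl)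
  centre-ends u (suc v , _ , free) = free (zero , here , inj₂ centre-leaf)

  finished : ∀ {p} ac → position (inside ∷ p) ac ≃ 𝟎
  finished (acc _) = ≃-match ((λ (u , _ , pl) → ⊥-elim (centre-ends u pl)) , λ ())
                             ((λ (u , _ , pl) → ⊥-elim (centre-ends u pl)) , λ ())

  -- While the centre is unselected, a leaf can be dominated only by itself.
  leaf-free : ∀ {p i} → i ∉ p → ¬ Dominated (outside ∷ p) (suc i)
  leaf-free i∉p (suc j , j∈S , inj₁ refl) = i∉p (drop-there j∈S)

  leaf-playable : ∀ {p i} → i ∉ p → Playable (outside ∷ p) (suc i)
  leaf-playable i∉p = _ , inj₁ refl , leaf-free i∉p

  -- With `playable-centre` as converse, the centre is playable exactly while a leaf is unselected,
  -- which is the condition attached to `centre` in `Move`.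
  centre-playable : ∀ {p i} → i ∉ p → Playable (outside ∷ p) zero
  centre-playable i∉p = _ , inj₂ centre-leaf , leaf-free i∉p

  playable-leaf : ∀ {p i} → Playable (outside ∷ p) (suc i) → i ∉ p
  playable-leaf {p} pl = playable⇒∉ {outside ∷ p} pl ∘ there

  playable-centre : ∀ {p} → Playable (outside ∷ p) zero → ∃[ i ] i ∉ p
  -- An undominated centre means that no leaf has been selected, so any leaf serves as witness; `i₀`
  -- guarantees that there is one.
  playable-centre (zero  , _ , free) = i₀ , λ i∈p → free (suc i₀ , there i∈p , inj₂ leaf-centre)
  playable-centre (suc i , _ , free) = i  , λ i∈p → free (suc i  , there i∈p , inj₁ refl)

  -- `Left` in the sense of remaining, not the player.
  record Left (p : Subset (length ls)) (a b c : ℕ) : Set where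
    constructor left
    field
      countA : count A (unselected ls p) ≡ a
      countB : count B (unselected ls p) ≡ b
      countC : count C (unselected ls p) ≡ c

  count-select : ∀ k {p i x n} → i ∉ p → lookup ls i ≡ x → count k (unselected ls p) ≡ n →
    count k (x ∷ unselected ls (p ∪ ⁅ i ⁆)) ≡ n
  count-select k {p} {i} i∉p refl eq = trans (sym (count-↭ k (unselected-select ls p i i∉p))) eq

  nonempty : ∀ {p a b c i} → Left p a b c → i ∉ p → Nonempty a b c
  nonempty {i = i} (left ea eb ec) i∉p with lookup ls i in eq
  ... | A with refl ← count-select A i∉p eq ea = some₁
  ... | B with refl ← count-select B i∉p eq eb = some₂
  ... | C with refl ← count-select C i∉p eq ec = some₃

  leaf-left : ∀ {p a b c} → Left p a b c → Nonempty a b c → ∃[ i ] i ∉ p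
  leaf-left (left ea _ _) some₁ = map₂ proj₂ (∃-unselected A ls _ ea)
  leaf-left (left _ eb _) some₂ = map₂ proj₂ (∃-unselected B ls _ eb)
  leaf-left (left _ _ ec) some₃ = map₂ proj₂ (∃-unselected C ls _ ec)

  selectA : ∀ {p a b c i} → i ∉ p → lookup ls i ≡ A → Left p a b c →
    ∃[ a′ ] a ≡ suc a′ × Left (p ∪ ⁅ i ⁆) a′ b c
  selectA i∉p e (left ea eb ec) =
    _ , sym (count-select A i∉p e ea) , left refl (count-select B i∉p e eb) (count-select C i∉p e ec)

  selectB : ∀ {p a b c i} → i ∉ p → lookup ls i ≡ B → Left p a b c →
    ∃[ b′ ] b ≡ suc b′ × Left (p ∪ ⁅ i ⁆) a b′ c
  selectB i∉p e (left ea eb ec) =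
    _ , sym (count-select B i∉p e eb) , left (count-select A i∉p e ea) refl (count-select C i∉p e ec)

  selectC : ∀ {p a b c i} → i ∉ p → lookup ls i ≡ C → Left p a b c →
    ∃[ c′ ] c ≡ suc c′ × Left (p ∪ ⁅ i ⁆) a b c′
  selectC i∉p e (left ea eb ec) =
    _ , sym (count-select C i∉p e ec) , left (count-select A i∉p e ea) (count-select B i∉p e eb) refl

  -- Each playable vertex gives a `Move` determined by its colour, and each `Move` is realised by
  -- some unselected vertex. Leaves of equal colour lead to positions with equal counts, so
  -- induction along the accessibility proof matches all options.
  position≃star : ∀ {p a b c} ac → Left p a b c → position (outside ∷ p) ac ≃ star a b c
  position≃star {p} {a} {b} {c} (acc rs) lf = ≃-match (l→ lf , l← lf) (r→ lf , r← lf)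
    where
    G = position (outside ∷ p) (acc rs)

    l→ : ∀ {a b c} → Left p a b c → ∀ m → ∃[ m′ ] leftOption G m ≃ aliceOption a b c m′
    l→ lf (zero  , _      , pl) =
      centre (nonempty lf (proj₂ (playable-centre pl))) , finished _
    l→ lf (suc i , inj₁ e , pl) with _ , refl , lf′ ← selectA (playable-leaf pl) e lf =
      own , position≃star (rs _) lf′
    l→ lf (suc i , inj₂ e , pl) with _ , refl , lf′ ← selectC (playable-leaf pl) e lf =
      common , position≃star (rs _) lf′

    l← : ∀ {a b c} → Left p a b c → ∀ m′ → ∃[ m ] leftOption G m ≃ aliceOption a b c m′
    l← lf (centre ne) =
      (zero , inj₂ refl , centre-playable (proj₂ (leaf-left lf ne))) , finished _
    l← lf@(left ea _ _) own with i , e , i∉p ← ∃-unselected A ls p ea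
      with _ , refl , lf′ ← selectA i∉p e lf =
      (suc i , inj₁ e , leaf-playable i∉p) , position≃star (rs _) lf′
    l← lf@(left _ _ ec) common with i , e , i∉p ← ∃-unselected C ls p ec
      with _ , refl , lf′ ← selectC i∉p e lf =
      (suc i , inj₂ e , leaf-playable i∉p) , position≃star (rs _) lf′

    r→ : ∀ {a b c} → Left p a b c → ∀ m → ∃[ m′ ] rightOption G m ≃ bobOption a b c m′
    r→ lf (zero  , _      , pl) =
      centre (Nonempty-swap (nonempty lf (proj₂ (playable-centre pl)))) , finished _
    r→ lf (suc i , inj₁ e , pl) with _ , refl , lf′ ← selectB (playable-leaf pl) e lf =
      own , position≃star (rs _) lf′
    r→ lf (suc i , inj₂ e , pl) with _ , refl , lf′ ← selectC (playable-leaf pl) e lf =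
      common , position≃star (rs _) lf′

    r← : ∀ {a b c} → Left p a b c → ∀ m′ → ∃[ m ] rightOption G m ≃ bobOption a b c m′
    r← lf (centre ne) =
      (zero , inj₂ refl , centre-playable (proj₂ (leaf-left lf (Nonempty-swap ne)))) , finished _
    r← lf@(left _ eb _) own with i , e , i∉p ← ∃-unselected B ls p eb
      with _ , refl , lf′ ← selectB i∉p e lf =
      (suc i , inj₁ e , leaf-playable i∉p) , position≃star (rs _) lf′
    r← lf@(left _ _ ec) common with i , e , i∉p ← ∃-unselected C ls p ec
      with _ , refl , lf′ ← selectC i∉p e lf =
      (suc i , inj₂ e , leaf-playable i∉p) , position≃star (rs _) lf′

starGame≃star : ∀ ls {a b c} → count A ls ≡ a → count B ls ≡ b → count C ls ≡ c →
  Nonempty a b c → starGame ls ≃ star a b c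
starGame≃star ls refl refl refl ne = position≃star (⊃-wellFounded ∅) (left (eq A) (eq B) (eq C))
  where
  eq : ∀ k → count k (unselected ls ∅) ≡ count k ls
  eq k = cong (count k) (unselected-∅ ls)

  some-leaf : ∀ {a b c} → count A ls ≡ a → count B ls ≡ b → count C ls ≡ c →
    Nonempty a b c → Fin (length ls)
  some-leaf ea _ _ some₁ = proj₁ (∃-unselected A ls ∅ (trans (eq A) ea))
  some-leaf _ eb _ some₂ = proj₁ (∃-unselected B ls ∅ (trans (eq B) eb))
  some-leaf _ _ ec some₃ = proj₁ (∃-unselected C ls ∅ (trans (eq C) ec))

  open Position ls (some-leaf refl refl refl ne)

-- Counts after removal, parity and differences.

count-remove : ∀ k ls → count k (remove k ls) ≡ 0
count-remove k [] = refl
count-remove k (x ∷ ls) with k ≟ x in eq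
... | yes _ = count-remove k ls
... | no _ rewrite eq = count-remove k ls

count-remove-≢ : ∀ k x → ¬ (k ≡ x) → ∀ ls → count k (remove x ls) ≡ count k ls
count-remove-≢ k x k≢x [] = refl
count-remove-≢ k x k≢x (y ∷ ls) with x ≟ y
... | no _ with k ≟ y
...   | yes _ = cong suc (count-remove-≢ k x k≢x ls)
...   | no _  = count-remove-≢ k x k≢x ls
count-remove-≢ k x k≢x (y ∷ ls) | yes refl with k ≟ y
...   | yes k≡x = ⊥-elim (k≢x k≡x)
...   | no _    = count-remove-≢ k x k≢x ls

odd⇒ : ∀ c → ¬ (2 ∣ c) → ∃[ k ] c ≡ k * 2 +ℕ 1
odd⇒ zero          odd = ⊥-elim (odd (2 ∣0))
odd⇒ (suc zero)    odd = 0 , refl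
odd⇒ (suc (suc c)) odd =
  let (k , e) = odd⇒ c (odd ∘ ∣m∣n⇒∣m+n ∣-refl) in suc k , cong (2 +ℕ_) e

Nonempty-sum : ∀ {a b c} → 1 ≤ a +ℕ b → Nonempty a b c
Nonempty-sum {suc a}         _ = some₁
Nonempty-sum {zero} {suc b}  _ = some₂

-- The hypothesis makes both truncated subtractions exact, so the exponent in the theorem is one
-- less than the surplus `d` in `oddStar≃`.
excess : ∀ {a b} → b +ℕ 2 ≤ a → a ≡ b +ℕ suc (a ∸ b ∸ 1)
excess {zero}  {suc b} ()
excess {suc (suc a)} {zero}  _       = refl
excess {suc a}       {suc b} (s≤s h) = cong suc (excess h)
excess {suc zero} {zero} (s≤s ())

differByOne : ∀ a b → ∣ a - b ∣ ≡ 1 → a ≡ b +ℕ 1 ⊎ b ≡ a +ℕ 1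
differByOne zero    b       e = inj₂ e
differByOne (suc a) zero    e = inj₁ e
differByOne (suc a) (suc b) e with differByOne a b e
... | inj₁ p = inj₁ (cong suc p)
... | inj₂ p = inj₂ (cong suc p)

theorem9 : (leaves : List Colour) (a b c : ℕ) →
    count A leaves ≡ a → count B leaves ≡ b → count C leaves ≡ c →
    1 ≤ a +ℕ b → 1 ≤ c →
    (2 ∣ c → starGame leaves ≈ starGame (remove C leaves)) ×
    (¬ (2 ∣ c) →
    (a ≡ b → starGame leaves ≈ ⋆) ×
    (∣ a - b ∣ ≡ 1 → starGame leaves ≈ ⋆2) ×
    (b +ℕ 2 ≤ a →
    starGame leaves ≈ ⟨ 𝟎 ∷ (↑[ a ∸ b ∸ 1 ] + ⋆) ∷ [] ∣ 𝟎 ∷ (↑[ a ∸ b ∸ 1 ] + ⋆) ∷ [] ⟩) ×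
    (a +ℕ 2 ≤ b →
    starGame leaves ≈ ⟨ 𝟎 ∷ (↓[ b ∸ a ∸ 1 ] + ⋆) ∷ [] ∣ 𝟎 ∷ (↓[ b ∸ a ∸ 1 ] + ⋆) ∷ [] ⟩))
theorem9 leaves a b c ea eb ec a+b≥1 _ = even , odd
  where
  byStar : ∀ {H} → star a b c ≃ H → starGame leaves ≈ H
  byStar e = ≃⇒≈ (≃-trans (starGame≃star leaves ea eb ec (Nonempty-sum a+b≥1)) e)

  even : 2 ∣ c → starGame leaves ≈ starGame (remove C leaves)
  -- All C leaves cancel in pairs, because a leaf of colour A or B keeps the star nonempty
  -- throughout.
  even (divides k refl) = byStar (≃-trans
    (subst (λ n → star a b n ≃ star a b 0) (+-identityʳ (k * 2)) (CCs-≃ a b 0 k (Nonempty-sum a+b≥1)))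
    (≃-sym (starGame≃star (remove C leaves)
      (trans (count-remove-≢ A C (λ ()) leaves) ea)
      (trans (count-remove-≢ B C (λ ()) leaves) eb)
      (count-remove C leaves) (Nonempty-sum a+b≥1))))

  odd : ¬ (2 ∣ c) → _
  odd 2∤c with k , refl ← odd⇒ c 2∤c =
    (λ a≡b → byStar (subst (λ n → star n b c ≃ ⋆) (trans (+-identityʳ b) (sym a≡b)) (oddStar-⋆ b k))) ,
    (λ e → byStar (differ (differByOne a b e))) ,
    (λ h → byStar (subst (λ n → star n b c ≃ pair (↑[ a ∸ b ∸ 1 ] + ⋆)) (sym (excess h))
                         (oddStar-↑ b (a ∸ b ∸ 1) k))) ,
    (λ h → byStar (subst (λ n → star a n c ≃ pair (↓[ b ∸ a ∸ 1 ] + ⋆)) (sym (excess h))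
                         (oddStar-↓ a (b ∸ a ∸ 1) k)))
    where
    differ : a ≡ b +ℕ 1 ⊎ b ≡ a +ℕ 1 → star a b c ≃ ⋆2
    differ (inj₁ refl) = oddStar-⋆2 b k
    -- `⋆2` is its own negative, so exchanging A and B leaves the value unchanged.
    differ (inj₂ refl) = mirror (oddStar-⋆2 a k) (neg-pair -⋆≃⋆)
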